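{- Let $t,\ell,m$ be integers with $1 \le t \le \ell \le m$. Then the minimum distance of the determinantal code $\widehat{C}_{\det}(t;\ell,m)$ equals $$q^{\ell+m-2}\,\nu_{t-1}(\ell-1,m-1).$$
   Context: $q$ is a prime power. For nonnegative integers $a,b,t$, $\nu_t(a,b)$ is the number of $a\times b$ matrices over $\mathbb{F}_q$ of rank at most $t$. Let $\widehat{\mathcal D}_t(\ell,m)\subset\mathbb{P}^{\ell m-1}(\mathbb{F}_q)=\mathbb{P}(\mathrm{Mat}_{\ell\times m}(\mathbb{F}_q))$ be the set of points $[M]$ with $M\ne 0$ and $\mathrm{rk}(M)\le t$; let $\hat n=|\widehat{\mathcal D}_t(\ell,m)|$, enumerate its points $P_1,\dots,P_{\hat n}$ and choose representatives $M_i\in\mathrm{Mat}_{\ell\times m}(\mathbb{F}_q)$ of $P_i$. The determinantal code $\widehat{C}_{\det}(t;\ell,m)\subseteq\mathbb{F}_q^{\hat n}$ is the image of the map sending a linear form $f=\sum_{i,j}f_{ij}X_{ij}$ (with $X=(X_{ij})$ an $\ell\times m$ matrix of indeterminates) to $(f(M_1),\dots,f(M_{\hat n}))$. Its minimum distance is the smallest Hamming weight of a nonzero codeword. -}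

module Defs where

open import Algebra.Apartness.Structures using (IsHeytingField)
open import Data.Fin.Base using (Fin)
import Data.Fin.Properties as Fin
open import Data.Fin.Subset using (Subset; inside; outside; ∣_∣; _∉_)
open import Data.Fin.Subset.Properties using (_∈?_)
open import Data.List.Base as List using (List)
open import Data.List.Extrema.Nat using (max)
open import Data.Nat.Base using (ℕ; zero; suc; _≤_)
open import Data.Nat.Properties using (_≤?_)
open import Data.Product.Base using (∃-syntax; _×_; _,_)
open import Data.Vec.Base as Vec using (Vec; []; _∷_; lookup; replicate; zipWith)
open import Data.Vec.Properties using (≡-dec)
open import Level using (0ℓ)
open import Function.Base using (_∘_)
open import Function.Bundles using (_↔_; Inverse)
open import Function.Properties.Inverse using (↔⇒↣)
open import Relation.Binary.Definitions using (DecidableEquality)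
open import Relation.Binary.PropositionalEquality using (_≡_; _≢_; subst)
open import Relation.Nullary.Decidable using (Dec; map′; _→-dec_; ¬?; via-injection)
open import Relation.Unary using (Pred; Decidable)

-- A Heyting field whose apartness relation is _≢_ is a field in the usual
-- sense: every nonzero element is invertible, and 0# ≢ 1# because 1# - 0# is
-- invertible.  The order q of a finite field is necessarily a prime power.
record FiniteField (q : ℕ) : Set₁ where
  infixl 6 _+_
  infixl 7 _*_
  infix  8 -_
  field
    Carrier        : Set
    _+_ _*_        : Carrier → Carrier → Carrier
    -_             : Carrier → Carrier
    0# 1#          : Carrier
    isHeytingField : IsHeytingField _≡_ _≢_ _+_ _*_ -_ 0# 1#
    enumeration    : Carrier ↔ Fin q

  open IsHeytingField isHeytingField public using (isCommutativeRing)

  infix 4 _≟_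
  _≟_ : DecidableEquality Carrier
  _≟_ = via-injection (↔⇒↣ enumeration) Fin._≟_

  elements : List Carrier
  elements = List.tabulate (Inverse.from enumeration)

allVecs : {A : Set} → List A → (n : ℕ) → List (Vec A n)
allVecs xs zero    = [] List.∷ List.[]
allVecs xs (suc n) = List.cartesianProductWith _∷_ xs (allVecs xs n)

module _ {q : ℕ} (𝔽 : FiniteField q) where
  open FiniteField 𝔽

  Mat : ℕ → ℕ → Set
  Mat a b = Vec (Vec Carrier b) a

  0ᵛ : ∀ {n} → Vec Carrier n
  0ᵛ = replicate _ 0#

  0ᴹ : ∀ {a b} → Mat a b
  0ᴹ = replicate _ 0ᵛ

  infixl 6 _+ᵛ_
  _+ᵛ_ : ∀ {n} → Vec Carrier n → Vec Carrier n → Vec Carrier n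
  _+ᵛ_ = zipWith _+_

  infixr 7 _·ᵛ_ _·ᴹ_
  _·ᵛ_ : ∀ {n} → Carrier → Vec Carrier n → Vec Carrier n
  x ·ᵛ v = Vec.map (x *_) v

  _·ᴹ_ : ∀ {a b} → Carrier → Mat a b → Mat a b
  x ·ᴹ M = Vec.map (x ·ᵛ_) M

  sum : ∀ {n} → Vec Carrier n → Carrier
  sum = Vec.foldr′ _+_ 0#

  linearCombination : ∀ {a b} → Vec Carrier a → Mat a b → Vec Carrier b
  linearCombination c M = Vec.foldr′ _+ᵛ_ 0ᵛ (zipWith _·ᵛ_ c M)

  -- The rows of M with index in S are linearly independent: S-indexed
  -- coefficient families are represented as vectors vanishing outside S.
  IndependentRows : ∀ {a b} → Mat a b → Subset a → Set
  IndependentRows {a} M S =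
    ∀ (c : Vec Carrier a) → (∀ i → i ∉ S → lookup c i ≡ 0#) →
    linearCombination c M ≡ 0ᵛ → c ≡ 0ᵛ

  allCarrier? : {P : Carrier → Set} → Decidable P → Dec (∀ x → P x)
  allCarrier? {P} P? = map′
    (λ h x → subst P (Inverse.strictlyInverseʳ enumeration x) (h (Inverse.to enumeration x)))
    (λ h i → h (Inverse.from enumeration i))
    (Fin.all? (P? ∘ Inverse.from enumeration))

  allVec? : ∀ {n} {P : Vec Carrier n → Set} → Decidable P → Dec (∀ v → P v)
  allVec? {zero}  P? = map′ (λ { p [] → p }) (λ h → h []) (P? [])
  allVec? {suc n} P? = map′ (λ { h (x ∷ v) → h x v }) (λ h x v → h (x ∷ v))
    (allCarrier? (λ x → allVec? (λ v → P? (x ∷ v))))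

  independentRows? : ∀ {a b} (M : Mat a b) → Decidable (IndependentRows M)
  independentRows? M S = allVec? λ c →
    Fin.all? (λ i → ¬? (i ∈? S) →-dec (lookup c i ≟ 0#)) →-dec
    (≡-dec _≟_ (linearCombination c M) 0ᵛ →-dec ≡-dec _≟_ c 0ᵛ)

  rank : ∀ {a b} → Mat a b → ℕ
  rank {a} M = max 0 (List.map ∣_∣ (List.filter (independentRows? M) subsets))
    where
    subsets : List (Subset a)
    subsets = allVecs (inside List.∷ outside List.∷ List.[]) a

  allMatrices : (a b : ℕ) → List (Mat a b)
  allMatrices a b = allVecs (allVecs elements b) a

  ν : (t a b : ℕ) → ℕ
  ν t a b = List.length (List.filter (λ M → rank M ≤? t) (allMatrices a b))

  infix 4 _∼_
  _∼_ : ∀ {a b} → Mat a b → Mat a b → Set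
  M ∼ N = ∃[ x ] x ≢ 0# × M ≡ x ·ᴹ N

  -- An enumeration P₁, …, Pₙ without repetition of the points [M] of
  -- ℙ(Mat ℓ m) with M ≢ 0ᴹ and rank M ≤ t, together with a chosen
  -- representative matrix Mᵢ of each Pᵢ.  The length n is thereby forced to be
  -- the number of such points.
  record ProjectiveEnumeration (t ℓ m n : ℕ) : Set where
    field
      representatives : Vec (Mat ℓ m) n
      nonzero         : ∀ i → lookup representatives i ≢ 0ᴹ
      rank≤t          : ∀ i → rank (lookup representatives i) ≤ t
      distinct        : ∀ i j → lookup representatives i ∼ lookup representatives j → i ≡ j
      complete        : ∀ M → M ≢ 0ᴹ → rank M ≤ t → ∃[ i ] M ∼ lookup representatives i

  -- The linear form ∑ fᵢⱼ Xᵢⱼ is given by its coefficient matrix.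
  evaluate : ∀ {ℓ m} → Mat ℓ m → Mat ℓ m → Carrier
  evaluate f M = sum (Vec.map sum (zipWith (zipWith _*_) f M))

  Code : ℕ → Set₁
  Code n = Pred (Vec Carrier n) 0ℓ

  Ĉdet : ∀ {t ℓ m n} → ProjectiveEnumeration t ℓ m n → Code n
  Ĉdet {ℓ = ℓ} {m} P c =
    ∃[ f ] Vec.map (evaluate {ℓ} {m} f) (ProjectiveEnumeration.representatives P) ≡ c

  weight : ∀ {n} → Vec Carrier n → ℕ
  weight = Vec.count (λ x → ¬? (x ≟ 0#))

  record IsMinimumDistance {n : ℕ} (C : Code n) (d : ℕ) : Set where
    field
      attained : ∃[ c ] C c × c ≢ 0ᵛ × weight c ≡ d
      minimal  : ∀ c → C c → c ≢ 0ᵛ → d ≤ weight c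

{-# OPTIONS --safe #-}
-- Codeword weights count matrices: every point [M] with F(M) ≠ 0 has a unique
-- representative with F(M) = 1, so the weight of the codeword of F is the number
-- of M with rank M ≤ t and F(M) = 1.  For F = X₁₁ the Schur complement of the
-- pivot turns this into q^(ℓ-1) q^(m-1) ν_{t-1}(ℓ-1, m-1).  For arbitrary F ≠ 0
-- there are at least as many: permute the rows so that the first row u of F is
-- nonzero.  When the lower rows of M are fixed, the first rows r giving rank ≤ t
-- form a subspace (or none exist), and on a subspace ⟨u, r⟩ + c takes the value 1
-- at least as often as ⟨u, r⟩ does, by translation.  This discards the lower rows
-- of F, and an invertible column operation turns ⟨u, r⟩ into X₁₁.

module Submission where

open import Defs
open import Algebra.Bundles using (CommutativeSemigroup; Ring)
import Algebra.Properties.CommutativeSemigroup as CommutativeSemigroupProperties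
import Algebra.Properties.Ring as RingProperties
open import Algebra.Structures using (IsCommutativeRing)
open import Algebra.Apartness.Structures using (IsHeytingField)
open import Data.Bool.Base using (true; false)
open import Data.Fin.Base as Fin using (Fin; zero; suc)
open import Data.Fin.Subset using (Subset; inside; outside; ∣_∣; _∉_)
open import Data.Fin.Subset.Properties using (drop-there)
import Data.Fin.Properties as Fin
open import Data.List.Base as List using (List)
open import Data.List.Extrema.Nat using (max≤v⁺; v≤max⁺)
open import Data.List.Membership.Propositional using (_∈_; lose)
open import Data.List.Membership.Propositional.Properties
  using (∈-lookup; ∈-tabulate⁺; ∈-filter⁺; ∈-filter⁻; ∈-map⁺; ∈-map⁻; ∈-cartesianProductWith⁺)
import Data.List.Relation.Unary.All as ListAll
open import Data.List.Relation.Unary.AllPairs using (_∷_; [])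
open import Data.List.Relation.Unary.Any as Any using (here; there)
open import Data.List.Relation.Unary.Any.Properties using (lookup-index)
open import Data.List.Relation.Unary.Unique.Propositional using (Unique)
open import Data.List.Relation.Unary.Unique.Propositional.Properties
  using (tabulate⁺; filter⁺; cartesianProductWith⁺)
open import Data.Nat.Base as ℕ using (ℕ; zero; suc; z≤n; s≤s; _≤_; _<_; _^_)
import Data.Nat.Properties as ℕ
open import Data.Product.Base using (∃; ∃-syntax; _×_; _,_; proj₁; proj₂; uncurry)
open import Data.Sum.Base using (inj₂)
open import Data.Unit.Base using (⊤; tt)
open import Data.Vec.Base as Vec using (Vec; []; _∷_; lookup; zipWith; count; head; tail)
open import Data.Vec.Properties
  using (∷-injective; ≡-dec; lookup-map; lookup-replicate; map-cong; map-const)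
open import Data.Vec.Relation.Unary.All as All using (All; []; _∷_)
open import Function.Base using (_∘_; id; case_of_)
open import Function.Bundles using (Inverse; Injection)
open import Function.Properties.Inverse using (↔⇒↣; ↔-sym)
open import Level using (0ℓ)
open import Relation.Binary.PropositionalEquality
open import Relation.Nullary using (Dec; yes; no; ¬_; contradiction)
open import Relation.Nullary.Decidable using (map′; ¬?; _×-dec_)
open import Relation.Unary using (Decidable)

-- Counting by injections

-- Injections in both directions bound the number of elements satisfying `P` by `n` from above and
-- from below. Injectivity of `to` compares the elements alone, so several proofs of `P x` still
-- count `x` once.
record HasSize {A : Set} (P : A → Set) (n : ℕ) : Set where
  field
    to             : ∀ x → P x → Fin n
    to-injective   : ∀ {x y} (p : P x) (p′ : P y) → to x p ≡ to y p′ → x ≡ y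
    from           : Fin n → A
    from-holds     : ∀ i → P (from i)
    from-injective : ∀ {i j} → from i ≡ from j → i ≡ j

open HasSize

size-≤ : ∀ {A B : Set} {P : A → Set} {R : B → Set} {m n} → HasSize P m → HasSize R n →
         (f : ∀ x → P x → B) → (∀ x p → R (f x p)) →
         (∀ {x y} p p′ → f x p ≡ f y p′ → x ≡ y) → m ≤ n
size-≤ P-size R-size f f-holds f-injective =
  Fin.injective⇒≤ λ eq → from-injective P-size
    (f-injective _ _ (to-injective R-size (f-holds _ (from-holds P-size _)) _ eq))

size-× : ∀ {A B : Set} {P : A → Set} {R : B → Set} {m n} → HasSize P m → HasSize R n →
         HasSize (λ (x , y) → P x × R y) (m ℕ.* n)
size-× {A} {B} {P} {R} {m} {n} S T = record
  { to             = λ xy pr → Fin.combine (i xy pr) (j xy pr)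
  ; to-injective   = λ {xy} {xy′} pr pr′ eq → cong₂ _,_
      (to-injective S _ _ (Fin.combine-injectiveˡ (i xy pr) (j xy pr) (i xy′ pr′) (j xy′ pr′) eq))
      (to-injective T _ _ (Fin.combine-injectiveʳ (i xy pr) (j xy pr) (i xy′ pr′) (j xy′ pr′) eq))
  ; from           = λ k → let i , j = Fin.remQuot {m} n k in from S i , from T j
  ; from-holds     = λ i → from-holds S _ , from-holds T _
  ; from-injective = λ {k} {l} eq → begin
      k                                         ≡⟨ Fin.combine-remQuot {m} n k ⟨
      uncurry Fin.combine (Fin.remQuot {m} n k)
        ≡⟨ cong₂ Fin.combine (from-injective S (cong proj₁ eq)) (from-injective T (cong proj₂ eq)) ⟩
      uncurry Fin.combine (Fin.remQuot {m} n l) ≡⟨ Fin.combine-remQuot {m} n l ⟩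
      l                                         ∎
  }
  where
  open ≡-Reasoning

  i : ∀ (xy : A × B) → P (proj₁ xy) × R (proj₂ xy) → Fin m
  i xy pr = to S (proj₁ xy) (proj₁ pr)

  j : ∀ (xy : A × B) → P (proj₁ xy) × R (proj₂ xy) → Fin n
  j xy pr = to T (proj₂ xy) (proj₂ pr)

size-map : ∀ {A B : Set} {P : A → Set} {R : B → Set} {n} (f : A → B) (g : B → A) →
           (∀ x → g (f x) ≡ x) → (∀ y → f (g y) ≡ y) →
           (∀ x → P x → R (f x)) → (∀ y → R y → P (g y)) → HasSize P n → HasSize R n
size-map f g g∘f f∘g P⇒R R⇒P S = record
  { to             = λ y r → to S (g y) (R⇒P y r)
  ; to-injective   = λ r r′ eq →
      trans (sym (f∘g _)) (trans (cong f (to-injective S _ _ eq)) (f∘g _))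
  ; from           = f ∘ from S
  ; from-holds     = λ i → P⇒R _ (from-holds S i)
  ; from-injective = λ eq → from-injective S
      (trans (sym (g∘f _)) (trans (cong g eq) (g∘f _)))
  }

lookup-injective : ∀ {A : Set} {xs : List A} → Unique xs → ∀ i j →
                   List.lookup xs i ≡ List.lookup xs j → i ≡ j
lookup-injective (x∉xs ∷ xs!) zero    zero    eq = refl
lookup-injective (x∉xs ∷ xs!) zero    (suc j) eq =
  contradiction eq (ListAll.lookup x∉xs (∈-lookup j))
lookup-injective (x∉xs ∷ xs!) (suc i) zero    eq =
  contradiction (sym eq) (ListAll.lookup x∉xs (∈-lookup i))
lookup-injective (x∉xs ∷ xs!) (suc i) (suc j) eq = cong suc (lookup-injective xs! i j eq)

size-unique : ∀ {A : Set} {P : A → Set} {xs : List A} → Unique xs →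
              (∀ x → P x → x ∈ xs) → (∀ x → x ∈ xs → P x) → HasSize P (List.length xs)
size-unique {xs = xs} xs! P⇒∈ ∈⇒P = record
  { to             = λ x p → Any.index (P⇒∈ x p)
  ; to-injective   = λ {x} {y} p p′ eq → begin
      x                                   ≡⟨ lookup-index (P⇒∈ x p) ⟩
      List.lookup xs (Any.index (P⇒∈ x p))  ≡⟨ cong (List.lookup xs) eq ⟩
      List.lookup xs (Any.index (P⇒∈ y p′)) ≡⟨ lookup-index (P⇒∈ y p′) ⟨
      y                                   ∎
  ; from           = List.lookup xs
  ; from-holds     = λ i → ∈⇒P _ (∈-lookup i)
  ; from-injective = λ {i} {j} → lookup-injective xs! i j
  }
  where open ≡-Reasoning

-- Positions are counted instead of values, because a codeword may repeat an entry.
size-count : ∀ {A : Set} {P : A → Set} (P? : Decidable P) {n} (v : Vec A n) →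
             HasSize (λ i → P (lookup v i)) (count P? v)
size-count P? [] = record
  { to = λ () ; to-injective = λ {} ; from = λ () ; from-holds = λ () ; from-injective = λ {} }
size-count P? (x ∷ v) with P? x | size-count P? v
... | yes p | S = record
  { to             = λ { zero _ → zero ; (suc i) r → suc (to S i r) }
  ; to-injective   = λ { {zero}  {zero}  _ _  _  → refl
                       ; {suc _} {suc _} r r′ eq →
                           cong suc (to-injective S r r′ (Fin.suc-injective eq)) }
  ; from           = λ { zero → zero ; (suc i) → suc (from S i) }
  ; from-holds     = λ { zero → p ; (suc i) → from-holds S i }
  ; from-injective = λ { {zero}  {zero}  _  → refl
                       ; {suc _} {suc _} eq → cong suc (from-injective S (Fin.suc-injective eq)) }
  }
... | no ¬p | S = record
  { to             = λ { zero p → contradiction p ¬p ; (suc i) r → to S i r }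
  ; to-injective   = λ { {zero}          p _  _  → contradiction p ¬p
                       ; {suc _} {zero}  _ p  _  → contradiction p ¬p
                       ; {suc _} {suc _} r r′ eq → cong suc (to-injective S r r′ eq) }
  ; from           = λ i → suc (from S i)
  ; from-holds     = from-holds S
  ; from-injective = λ eq → from-injective S (Fin.suc-injective eq)
  }

size-Vec : ∀ {A : Set} {q} → HasSize {A} (λ _ → ⊤) q → ∀ n → HasSize {Vec A n} (λ _ → ⊤) (q ^ n)
size-Vec S zero = record
  { to             = λ _ _ → zero
  ; to-injective   = λ { {[]} {[]} _ _ _ → refl }
  ; from           = λ _ → []
  ; from-holds     = λ _ → tt
  ; from-injective = λ { {zero} {zero} _ → refl }
  }
size-Vec S (suc n) = size-map (uncurry _∷_) (λ { (x ∷ v) → x , v }) (λ _ → refl)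
  (λ { (x ∷ v) → refl }) _ _ (size-× S (size-Vec S n))

∈-allVecs : ∀ {A : Set} {xs : List A} → (∀ x → x ∈ xs) → ∀ {n} (v : Vec A n) → v ∈ allVecs xs n
∈-allVecs ∈xs []      = here refl
∈-allVecs ∈xs (x ∷ v) = ∈-cartesianProductWith⁺ _∷_ (∈xs x) (∈-allVecs ∈xs v)

allVecs-unique : ∀ {A : Set} {xs : List A} → Unique xs → ∀ n → Unique (allVecs xs n)
allVecs-unique xs! zero    = ListAll.[] ∷ []
allVecs-unique xs! (suc n) = cartesianProductWith⁺ _∷_ ∷-injective xs! (allVecs-unique xs! n)

module _ {q : ℕ} (𝔽 : FiniteField q) where
  open FiniteField 𝔽
  open IsCommutativeRing isCommutativeRing hiding (refl; sym; trans; zero)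

  +-commutativeSemigroup : CommutativeSemigroup 0ℓ 0ℓ
  +-commutativeSemigroup = record { isCommutativeSemigroup = +-isCommutativeSemigroup }

  *-commutativeSemigroup : CommutativeSemigroup 0ℓ 0ℓ
  *-commutativeSemigroup = record { isCommutativeSemigroup = *-isCommutativeSemigroup }

  ring : Ring 0ℓ 0ℓ
  ring = record { isRing = isRing }

  open CommutativeSemigroupProperties +-commutativeSemigroup using (interchange)
    renaming (x∙yz≈y∙xz to x+[y+z]≡y+[x+z])
  open CommutativeSemigroupProperties *-commutativeSemigroup
    using () renaming (x∙yz≈y∙xz to x*yz≡y*xz)
  open RingProperties ring
    using (-‿distribˡ-*; -‿distribʳ-*; -0#≈0#; -‿+-comm) renaming (+-inverseˡ-unique to neg-unique)

  private
    infixl 6 _⊕_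
    infixr 7 _⊙_

    _⊕_ : ∀ {n} → Vec Carrier n → Vec Carrier n → Vec Carrier n
    _⊕_ = _+ᵛ_ 𝔽

    _⊙_ : ∀ {n} → Carrier → Vec Carrier n → Vec Carrier n
    _⊙_ = _·ᵛ_ 𝔽

    𝟎 : ∀ {n} → Vec Carrier n
    𝟎 = 0ᵛ 𝔽

    lc : ∀ {a b} → Vec Carrier a → Mat 𝔽 a b → Vec Carrier b
    lc = linearCombination 𝔽

    ⟨_,_⟩ : ∀ {n} → Vec Carrier n → Vec Carrier n → Carrier
    ⟨ u , r ⟩ = sum 𝔽 (zipWith _*_ u r)

  -- Field arithmetic

  x-0≡x : ∀ x → x - 0# ≡ x
  x-0≡x x = trans (cong (x +_) -0#≈0#) (+-identityʳ x)

  1≢0 : 1# ≢ 0#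
  1≢0 = IsHeytingField.invertible⇒# isHeytingField
    (1# , trans (*-identityˡ _) (x-0≡x 1#) , trans (*-identityʳ _) (x-0≡x 1#))

  inverse : ∀ {x} → x ≢ 0# → ∃[ y ] y * x ≡ 1#
  inverse {x} x≢0 with y , y*x≡1 , _ ← IsHeytingField.#⇒invertible isHeytingField x≢0 =
    y , trans (cong (y *_) (sym (x-0≡x x))) y*x≡1

  solve-linear : ∀ {x y r s} → y * x ≡ 1# → x * r + s ≡ 0# → r ≡ (- y) * s
  solve-linear {x} {y} {r} {s} y*x≡1 eq = begin
    r           ≡⟨ *-identityˡ r ⟨
    1# * r      ≡⟨ cong (_* r) y*x≡1 ⟨
    y * x * r   ≡⟨ *-assoc y x r ⟩
    y * (x * r) ≡⟨ cong (y *_) (neg-unique _ _ eq) ⟩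
    y * (- s)   ≡⟨ -‿distribʳ-* y s ⟨
    - (y * s)   ≡⟨ -‿distribˡ-* y s ⟩
    (- y) * s   ∎
    where open ≡-Reasoning

  -- Vectors

  ⊕-identityˡ : ∀ {n} (v : Vec Carrier n) → 𝟎 ⊕ v ≡ v
  ⊕-identityˡ []      = refl
  ⊕-identityˡ (x ∷ v) = cong₂ _∷_ (+-identityˡ x) (⊕-identityˡ v)

  ⊕-identityʳ : ∀ {n} (v : Vec Carrier n) → v ⊕ 𝟎 ≡ v
  ⊕-identityʳ []      = refl
  ⊕-identityʳ (x ∷ v) = cong₂ _∷_ (+-identityʳ x) (⊕-identityʳ v)

  ⊕-assoc : ∀ {n} (u v w : Vec Carrier n) → u ⊕ v ⊕ w ≡ u ⊕ (v ⊕ w)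
  ⊕-assoc []      []      []      = refl
  ⊕-assoc (x ∷ u) (y ∷ v) (z ∷ w) = cong₂ _∷_ (+-assoc x y z) (⊕-assoc u v w)

  ⊕-comm : ∀ {n} (u v : Vec Carrier n) → u ⊕ v ≡ v ⊕ u
  ⊕-comm []      []      = refl
  ⊕-comm (x ∷ u) (y ∷ v) = cong₂ _∷_ (+-comm x y) (⊕-comm u v)

  ⊕-interchange : ∀ {n} (u v w z : Vec Carrier n) → (u ⊕ v) ⊕ (w ⊕ z) ≡ (u ⊕ w) ⊕ (v ⊕ z)
  ⊕-interchange []      []      []      []      = refl
  ⊕-interchange (a ∷ u) (b ∷ v) (c ∷ w) (d ∷ z) =
    cong₂ _∷_ (interchange a b c d) (⊕-interchange u v w z)

  ⊙-distribˡ : ∀ {n} x (u v : Vec Carrier n) → x ⊙ (u ⊕ v) ≡ x ⊙ u ⊕ x ⊙ v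
  ⊙-distribˡ x []      []      = refl
  ⊙-distribˡ x (y ∷ u) (z ∷ v) = cong₂ _∷_ (distribˡ x y z) (⊙-distribˡ x u v)

  ⊙-distribʳ : ∀ {n} x y (v : Vec Carrier n) → (x + y) ⊙ v ≡ x ⊙ v ⊕ y ⊙ v
  ⊙-distribʳ x y []      = refl
  ⊙-distribʳ x y (z ∷ v) = cong₂ _∷_ (distribʳ z x y) (⊙-distribʳ x y v)

  ⊙-assoc : ∀ {n} x y (v : Vec Carrier n) → (x * y) ⊙ v ≡ x ⊙ y ⊙ v
  ⊙-assoc x y []      = refl
  ⊙-assoc x y (z ∷ v) = cong₂ _∷_ (*-assoc x y z) (⊙-assoc x y v)

  ⊙-identity : ∀ {n} (v : Vec Carrier n) → 1# ⊙ v ≡ v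
  ⊙-identity []      = refl
  ⊙-identity (x ∷ v) = cong₂ _∷_ (*-identityˡ x) (⊙-identity v)

  ⊙-zeroˡ : ∀ {n} (v : Vec Carrier n) → 0# ⊙ v ≡ 𝟎
  ⊙-zeroˡ []      = refl
  ⊙-zeroˡ (x ∷ v) = cong₂ _∷_ (zeroˡ x) (⊙-zeroˡ v)

  ⊙-zeroʳ : ∀ {n} x → x ⊙ 𝟎 {n} ≡ 𝟎
  ⊙-zeroʳ {zero}  x = refl
  ⊙-zeroʳ {suc n} x = cong₂ _∷_ (zeroʳ x) (⊙-zeroʳ x)

  0⊙⊕ : ∀ {n} (u v : Vec Carrier n) → 0# ⊙ u ⊕ v ≡ v
  0⊙⊕ u v = trans (cong (_⊕ v) (⊙-zeroˡ u)) (⊕-identityˡ v)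

  1⊙⊕0 : ∀ {n} (v : Vec Carrier n) → 1# ⊙ v ⊕ 𝟎 ≡ v
  1⊙⊕0 v = trans (⊕-identityʳ _) (⊙-identity v)

  ⊙-cancelˡ : ∀ {n x y} → y * x ≡ 1# → (v : Vec Carrier n) → y ⊙ x ⊙ v ≡ v
  ⊙-cancelˡ {x = x} {y} y*x≡1 v =
    trans (sym (⊙-assoc y x v)) (trans (cong (_⊙ v) y*x≡1) (⊙-identity v))

  ⊙⊕-solve : ∀ {n x y} → y * x ≡ 1# → (r s : Vec Carrier n) → x ⊙ r ⊕ s ≡ 𝟎 → r ≡ (- y) ⊙ s
  ⊙⊕-solve y*x≡1 []      []      eq = refl
  ⊙⊕-solve y*x≡1 (_ ∷ r) (_ ∷ s) eq with eq₀ , eq′ ← ∷-injective eq =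
    cong₂ _∷_ (solve-linear y*x≡1 eq₀) (⊙⊕-solve y*x≡1 r s eq′)

  ⊕-⊙-cancel : ∀ {n} (r : Vec Carrier n) x v → (r ⊕ x ⊙ v) ⊕ (- x) ⊙ v ≡ r
  ⊕-⊙-cancel r x v = begin
    (r ⊕ x ⊙ v) ⊕ (- x) ⊙ v ≡⟨ ⊕-assoc r _ _ ⟩
    r ⊕ (x ⊙ v ⊕ (- x) ⊙ v) ≡⟨ cong (r ⊕_) (⊙-distribʳ x (- x) v) ⟨
    r ⊕ (x - x) ⊙ v         ≡⟨ cong (λ y → r ⊕ y ⊙ v) (-‿inverseʳ x) ⟩
    r ⊕ 0# ⊙ v              ≡⟨ cong (r ⊕_) (⊙-zeroˡ v) ⟩
    r ⊕ 𝟎                   ≡⟨ ⊕-identityʳ r ⟩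
    r                       ∎
    where open ≡-Reasoning

  ⊕-⊙-cancel′ : ∀ {n} (r : Vec Carrier n) x v → (r ⊕ (- x) ⊙ v) ⊕ x ⊙ v ≡ r
  ⊕-⊙-cancel′ r x v = begin
    (r ⊕ (- x) ⊙ v) ⊕ x ⊙ v ≡⟨ ⊕-assoc r _ _ ⟩
    r ⊕ ((- x) ⊙ v ⊕ x ⊙ v) ≡⟨ cong (r ⊕_) (⊕-comm ((- x) ⊙ v) (x ⊙ v)) ⟩
    r ⊕ (x ⊙ v ⊕ (- x) ⊙ v) ≡⟨ ⊕-assoc r _ _ ⟨
    (r ⊕ x ⊙ v) ⊕ (- x) ⊙ v ≡⟨ ⊕-⊙-cancel r x v ⟩
    r                       ∎
    where open ≡-Reasoning

  ⟨,⟩-⊕ : ∀ {n} (u r s : Vec Carrier n) → ⟨ u , r ⊕ s ⟩ ≡ ⟨ u , r ⟩ + ⟨ u , s ⟩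
  ⟨,⟩-⊕ []      []      []      = sym (+-identityˡ 0#)
  ⟨,⟩-⊕ (a ∷ u) (x ∷ r) (y ∷ s) = trans (cong₂ _+_ (distribˡ a x y) (⟨,⟩-⊕ u r s))
    (interchange (a * x) (a * y) ⟨ u , r ⟩ ⟨ u , s ⟩)

  ⟨,⟩-⊙ : ∀ {n} x (u r : Vec Carrier n) → ⟨ u , x ⊙ r ⟩ ≡ x * ⟨ u , r ⟩
  ⟨,⟩-⊙ x []      []      = sym (zeroʳ x)
  ⟨,⟩-⊙ x (a ∷ u) (y ∷ r) = begin
    a * (x * y) + ⟨ u , x ⊙ r ⟩ ≡⟨ cong₂ _+_ (x*yz≡y*xz a x y) (⟨,⟩-⊙ x u r) ⟩
    x * (a * y) + x * ⟨ u , r ⟩ ≡⟨ distribˡ x (a * y) ⟨ u , r ⟩ ⟨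
    x * (a * y + ⟨ u , r ⟩)     ∎
    where open ≡-Reasoning

  ⟨𝟎,⟩ : ∀ {n} (r : Vec Carrier n) → ⟨ 𝟎 , r ⟩ ≡ 0#
  ⟨𝟎,⟩ []      = refl
  ⟨𝟎,⟩ (x ∷ r) = trans (cong₂ _+_ (zeroˡ x) (⟨𝟎,⟩ r)) (+-identityˡ 0#)

  evaluate-· : ∀ {a b} x (F M : Mat 𝔽 a b) → evaluate 𝔽 F (_·ᴹ_ 𝔽 x M) ≡ x * evaluate 𝔽 F M
  evaluate-· x []      []      = sym (zeroʳ x)
  evaluate-· x (u ∷ F) (r ∷ M) =
    trans (cong₂ _+_ (⟨,⟩-⊙ x u r) (evaluate-· x F M)) (sym (distribˡ x ⟨ u , r ⟩ (evaluate 𝔽 F M)))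

  evaluate-0ˡ : ∀ {a b} (M : Mat 𝔽 a b) → evaluate 𝔽 (0ᴹ 𝔽) M ≡ 0#
  evaluate-0ˡ []      = refl
  evaluate-0ˡ (r ∷ M) = trans (cong₂ _+_ (⟨𝟎,⟩ r) (evaluate-0ˡ M)) (+-identityˡ 0#)

  -- Linear combinations of rows

  -- Column operations act as one such map applied to every row; deleting the first column,
  -- prepending a zero column, scaling and straightening are all of this kind.
  record Linear {m n} (h : Vec Carrier m → Vec Carrier n) : Set where
    field
      ⊕-homo : ∀ r s → h (r ⊕ s) ≡ h r ⊕ h s
      ⊙-homo : ∀ x r → h (x ⊙ r) ≡ x ⊙ h r

    𝟎-homo : h 𝟎 ≡ 𝟎
    𝟎-homo = begin
      h 𝟎        ≡⟨ cong h (⊙-zeroˡ 𝟎) ⟨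
      h (0# ⊙ 𝟎) ≡⟨ ⊙-homo 0# 𝟎 ⟩
      0# ⊙ h 𝟎   ≡⟨ ⊙-zeroˡ (h 𝟎) ⟩
      𝟎          ∎
      where open ≡-Reasoning

    lc-homo : ∀ {a} (c : Vec Carrier a) M → h (lc c M) ≡ lc c (Vec.map h M)
    lc-homo []      []      = 𝟎-homo
    lc-homo (x ∷ c) (r ∷ M) = trans (⊕-homo _ _) (cong₂ _⊕_ (⊙-homo x r) (lc-homo c M))

  lc-⊕ : ∀ {a b} (c d : Vec Carrier a) (M : Mat 𝔽 a b) → lc (c ⊕ d) M ≡ lc c M ⊕ lc d M
  lc-⊕ []      []      []      = sym (⊕-identityˡ 𝟎)
  lc-⊕ (x ∷ c) (y ∷ d) (r ∷ M) = trans (cong₂ _⊕_ (⊙-distribʳ x y r) (lc-⊕ c d M))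
    (⊕-interchange (x ⊙ r) (y ⊙ r) (lc c M) (lc d M))

  lc-⊙ : ∀ {a b} x (c : Vec Carrier a) (M : Mat 𝔽 a b) → lc (x ⊙ c) M ≡ x ⊙ lc c M
  lc-⊙ x []      []      = sym (⊙-zeroʳ x)
  lc-⊙ x (y ∷ c) (r ∷ M) = trans (cong₂ _⊕_ (⊙-assoc x y r) (lc-⊙ x c M))
    (sym (⊙-distribˡ x (y ⊙ r) (lc c M)))

  lc-𝟎 : ∀ {a b} (M : Mat 𝔽 a b) → lc 𝟎 M ≡ 𝟎
  lc-𝟎 []      = refl
  lc-𝟎 (r ∷ M) = trans (0⊙⊕ r _) (lc-𝟎 M)

  Span : ∀ {a b} → Mat 𝔽 a b → Vec Carrier b → Set
  Span M r = ∃[ c ] lc c M ≡ r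

  span-⊕ : ∀ {a b} {M : Mat 𝔽 a b} {r s} → Span M r → Span M s → Span M (r ⊕ s)
  span-⊕ {M = M} (c , refl) (d , refl) = c ⊕ d , lc-⊕ c d M

  span-⊙ : ∀ {a b} {M : Mat 𝔽 a b} x {r} → Span M r → Span M (x ⊙ r)
  span-⊙ {M = M} x (c , refl) = x ⊙ c , lc-⊙ x c M

  span-𝟎 : ∀ {a b} {M : Mat 𝔽 a b} → Span M 𝟎
  span-𝟎 {M = M} = 𝟎 , lc-𝟎 M

  span-here : ∀ {a b} {M : Mat 𝔽 a b} r → Span (r ∷ M) r
  span-here {M = M} r = 1# ∷ 𝟎 , trans (cong (1# ⊙ r ⊕_) (lc-𝟎 M)) (1⊙⊕0 r)

  span-there : ∀ {a b} {M : Mat 𝔽 a b} r {s} → Span M s → Span (r ∷ M) s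
  span-there r (c , eq) = 0# ∷ c , trans (0⊙⊕ r _) eq

  span-lc : ∀ {a b k} {N : Mat 𝔽 k b} {M : Mat 𝔽 a b} → All (Span N) M → ∀ c → Span N (lc c M)
  span-lc []       []      = span-𝟎
  span-lc (s ∷ ss) (x ∷ c) = span-⊕ (span-⊙ x s) (span-lc ss c)

  span-trans : ∀ {a b k} {N : Mat 𝔽 k b} {M : Mat 𝔽 a b} {r} → All (Span N) M → Span M r → Span N r
  span-trans ss (c , refl) = span-lc ss c

  span-rows : ∀ {a b} (M : Mat 𝔽 a b) → All (Span M) M
  span-rows []      = []
  span-rows (r ∷ M) = span-here r ∷ All.map (span-there r) (span-rows M)

  span-map : ∀ {a m n} {h : Vec Carrier m → Vec Carrier n} → Linear h →
             ∀ {M : Mat 𝔽 a m} {r} → Span M r → Span (Vec.map h M) (h r)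
  span-map L {M} (c , refl) = c , sym (Linear.lc-homo L c M)

  -- Rank

  size-Carrier : HasSize {Carrier} (λ _ → ⊤) q
  size-Carrier = record
    { to             = λ x _ → Inverse.to enumeration x
    ; to-injective   = λ _ _ → Injection.injective (↔⇒↣ enumeration)
    ; from           = Inverse.from enumeration
    ; from-holds     = λ _ → tt
    ; from-injective = Injection.injective (↔⇒↣ (↔-sym enumeration))
    }

  -- The distinct elements 0 and 1 embed `Fin 2` into the field. This makes powers of `q` strictly
  -- increasing in the exponent.
  1<q : 1 < q
  1<q = size-≤ size-bit size-Carrier (λ i _ → bit i) (λ _ _ → tt) λ _ _ → bit-injective
    where
    bit : Fin 2 → Carrier
    bit zero       = 0#
    bit (suc zero) = 1#
    bit-injective : ∀ {i j} → bit i ≡ bit j → i ≡ j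
    bit-injective {zero}     {zero}     eq = refl
    bit-injective {zero}     {suc zero} eq = contradiction (sym eq) 1≢0
    bit-injective {suc zero} {zero}     eq = contradiction eq 1≢0
    bit-injective {suc zero} {suc zero} eq = refl
    size-bit : HasSize {Fin 2} (λ _ → ⊤) 2
    size-bit = record { to = λ i _ → i ; to-injective = λ _ _ → id ; from = id
                      ; from-holds = λ _ → tt ; from-injective = id }

  ∈-elements : ∀ x → x ∈ elements
  ∈-elements x = subst (_∈ elements) (Inverse.strictlyInverseʳ enumeration x)
    (∈-tabulate⁺ (Inverse.to enumeration x))

  elements-unique : Unique elements
  elements-unique = tabulate⁺ (HasSize.from-injective size-Carrier)

  -- Cardinalities give `q ^ k ≤ q ^ l`, and `1 < q` lets the exponents be compared. Counting takes
  -- the place of Steinitz exchange, so an arbitrary choice of coefficients can serve as `φ`.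
  dimension-≤ : ∀ {k l} (φ : Vec Carrier k → Vec Carrier l) → (∀ {v w} → φ v ≡ φ w → v ≡ w) → k ≤ l
  dimension-≤ {k} {l} φ φ-injective = ℕ.≮⇒≥ λ l<k → ℕ.<⇒≱ (ℕ.^-monoʳ-< q 1<q l<k)
    (size-≤ (size-Vec size-Carrier k) (size-Vec size-Carrier l) (λ v _ → φ v) (λ _ _ → tt)
      λ _ _ → φ-injective)

  anyVec? : ∀ {n} {P : Vec Carrier n → Set} → Decidable P → Dec (∃ P)
  anyVec? {n} P? = map′ Any.satisfied (λ (v , p) → lose (∈-allVecs ∈-elements v) p)
    (Any.any? P? (allVecs elements n))

  span? : ∀ {a b} (M : Mat 𝔽 a b) → Decidable (Span M)
  span? M r = anyVec? λ c → ≡-dec _≟_ (lc c M) r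

  -- A greedy rank, built from the last row upward: a row counts when it lies outside the span of
  -- the rows below it. Unlike the maximum in `rank`, it supports induction on rows; `rank≡rk` links
  -- the two.
  rk : ∀ {a b} → Mat 𝔽 a b → ℕ
  rk []      = 0
  rk (r ∷ M) with span? M r
  ... | yes _ = rk M
  ... | no _  = suc (rk M)

  -- Parametrises the coefficient families that `IndependentRows` admits by a space of dimension
  -- `∣ S ∣`, so that sizes of row sets become exponents of `q`.
  embed : ∀ {a} (S : Subset a) → Vec Carrier ∣ S ∣ → Vec Carrier a
  embed []           []      = []
  embed (inside ∷ S) (x ∷ v) = x ∷ embed S v
  embed (outside ∷ S) v      = 0# ∷ embed S v

  embed-injective : ∀ {a} (S : Subset a) {v w} → embed S v ≡ embed S w → v ≡ w
  embed-injective []            {[]}    {[]}    eq = refl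
  embed-injective (inside ∷ S)  {x ∷ v} {y ∷ w} eq with x≡y , eq′ ← ∷-injective eq =
    cong₂ _∷_ x≡y (embed-injective S eq′)
  embed-injective (outside ∷ S) eq = embed-injective S (proj₂ (∷-injective eq))

  Supported : ∀ {a} → Subset a → Vec Carrier a → Set
  Supported S c = ∀ i → i ∉ S → lookup c i ≡ 0#

  supported-⊕⊙ : ∀ {a} {S : Subset a} x c d → Supported S c → Supported S d →
                 Supported S (c ⊕ x ⊙ d)
  supported-⊕⊙ x (y ∷ c) (z ∷ d) Sc Sd zero    i∉S rewrite Sc zero i∉S | Sd zero i∉S =
    trans (+-identityˡ _) (zeroʳ x)
  supported-⊕⊙ {S = _ ∷ S} x (y ∷ c) (z ∷ d) Sc Sd (suc i) i∉S =
    supported-⊕⊙ {S = S} x c d (λ j j∉S → Sc (suc j) (j∉S ∘ drop-there))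
      (λ j j∉S → Sd (suc j) (j∉S ∘ drop-there)) i (i∉S ∘ Vec.there)

  supported-embed : ∀ {a} (S : Subset a) v → Supported S (embed S v)
  supported-embed (inside ∷ S)  (x ∷ v) zero    i∉S = contradiction Vec.here i∉S
  supported-embed (inside ∷ S)  (x ∷ v) (suc i) i∉S = supported-embed S v i (i∉S ∘ Vec.there)
  supported-embed (outside ∷ S) v       zero    i∉S = refl
  supported-embed (outside ∷ S) v       (suc i) i∉S = supported-embed S v i (i∉S ∘ Vec.there)

  -- The difference of the two coefficient vectors is supported on `S` and yields the zero
  -- combination, so independence makes it vanish.
  independent-injective : ∀ {a b} {M : Mat 𝔽 a b} {S} → IndependentRows 𝔽 M S →
                          ∀ {v w} → lc (embed S v) M ≡ lc (embed S w) M → v ≡ w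
  independent-injective {M = M} {S} ind {v} {w} eq = embed-injective S (begin
    c                      ≡⟨ ⊕-⊙-cancel′ c 1# d ⟨
    c ⊕ (- 1#) ⊙ d ⊕ 1# ⊙ d ≡⟨ cong (_⊕ 1# ⊙ d) (ind _ (supported-⊕⊙ {S = S} (- 1#) c d
                                (supported-embed S v) (supported-embed S w)) difference) ⟩
    𝟎 ⊕ 1# ⊙ d             ≡⟨ ⊕-identityˡ _ ⟩
    1# ⊙ d                 ≡⟨ ⊙-identity d ⟩
    d                      ∎)
    where
    open ≡-Reasoning
    c = embed S v
    d = embed S w
    difference : lc (c ⊕ (- 1#) ⊙ d) M ≡ 𝟎
    difference = begin
      lc (c ⊕ (- 1#) ⊙ d) M          ≡⟨ lc-⊕ c _ M ⟩
      lc c M ⊕ lc ((- 1#) ⊙ d) M     ≡⟨ cong₂ _⊕_ eq (lc-⊙ (- 1#) d M) ⟩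
      lc d M ⊕ (- 1#) ⊙ lc d M       ≡⟨ cong (_⊕ (- 1#) ⊙ lc d M) (⊕-identityˡ _) ⟨
      𝟎 ⊕ lc d M ⊕ (- 1#) ⊙ lc d M   ≡⟨ cong (λ r → 𝟎 ⊕ r ⊕ (- 1#) ⊙ lc d M) (⊙-identity _) ⟨
      𝟎 ⊕ 1# ⊙ lc d M ⊕ (- 1#) ⊙ lc d M ≡⟨ ⊕-⊙-cancel 𝟎 1# (lc d M) ⟩
      𝟎                              ∎

  Generates : ∀ {a b} → Mat 𝔽 a b → Subset a → Set
  Generates M T = ∀ {r} → Span M r → ∃[ v ] lc (embed T v) M ≡ r

  -- Each combination of the `S`-rows can be rewritten with coefficients on the `T`-rows. The new
  -- coefficients determine the combination, which by independence determines the old ones; hence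
  -- the rewriting is injective and `dimension-≤` applies.
  exchange : ∀ {a b k} {M : Mat 𝔽 a b} {N : Mat 𝔽 k b} {S T} → IndependentRows 𝔽 M S →
             Generates N T → All (Span N) M → ∣ S ∣ ≤ ∣ T ∣
  exchange {M = M} {N} {S} {T} ind gen M⊆N = dimension-≤ (proj₁ ∘ coefficients) λ {v} {w} eq →
    independent-injective ind (trans (sym (proj₂ (coefficients v)))
      (trans (cong (λ c → lc (embed T c) N) eq) (proj₂ (coefficients w))))
    where
    coefficients : ∀ v → ∃[ w ] lc (embed T w) N ≡ lc (embed S v) M
    coefficients v = gen (span-lc M⊆N (embed S v))

  tail-zero : ∀ {a b r} {M : Mat 𝔽 a b} {s} S → IndependentRows 𝔽 M S → ∀ c →
              Supported (s ∷ S) (0# ∷ c) → lc (0# ∷ c) (r ∷ M) ≡ 𝟎 → 0# ∷ c ≡ 𝟎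
  tail-zero {r = r} S ind c supp eq = cong (0# ∷_)
    (ind c (λ i i∉S → supp (suc i) (i∉S ∘ drop-there)) (trans (sym (0⊙⊕ r _)) eq))

  -- Keeps exactly the rows that `rk` counts: a row in the span of the later ones adds nothing to
  -- the row space, and any other row preserves independence.
  basis : ∀ {a b} (M : Mat 𝔽 a b) → ∃[ S ] ∣ S ∣ ≡ rk M × IndependentRows 𝔽 M S × Generates M S
  basis []      = [] , refl , (λ { [] _ _ → refl }) , λ { ([] , eq) → [] , eq }
  basis (r ∷ M) with span? M r | basis M
  ... | yes r∈M | S , S-size , ind , gen = outside ∷ S , S-size
    , (λ { (x ∷ c) supp eq → case supp zero (λ ()) of λ { refl → tail-zero S ind c supp eq } })
    , (λ s → let v , eq = gen (span-trans (r∈M ∷ span-rows M) s) in v , trans (0⊙⊕ r _) eq)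
  ... | no r∉M | S , S-size , ind , gen = inside ∷ S , cong suc S-size
    , independent
    , λ { (x ∷ c , refl) → let v , eq = gen (c , refl) in x ∷ v , cong (x ⊙ r ⊕_) eq }
    where
    independent : IndependentRows 𝔽 (r ∷ M) (inside ∷ S)
    independent (x ∷ c) supp eq with x ≟ 0#
    ... | yes refl = tail-zero S ind c supp eq
    -- A relation with nonzero coefficient at `r` can be solved for `r`, which would put `r` into
    -- the span of `M`.
    ... | no x≢0 with y , y*x≡1 ← inverse x≢0 =
      contradiction (subst (Span M) (sym (⊙⊕-solve y*x≡1 r _ eq)) (span-⊙ (- y) (c , refl))) r∉M

  -- An `exchange` between bases of the two matrices. Bounds under row operations thereby reduce to
  -- exhibiting the new rows as combinations of the old ones.
  rk-mono : ∀ {a b k} {M : Mat 𝔽 a b} {N : Mat 𝔽 k b} → All (Span N) M → rk M ≤ rk N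
  rk-mono {M = M} {N} M⊆N with S , S-size , ind , _ ← basis M | T , T-size , _ , gen ← basis N =
    subst₂ _≤_ S-size T-size (exchange {S = S} {T} ind gen M⊆N)

  -- Every independent set competing in the maximum is bounded by `exchange` against the greedy
  -- basis, and that basis is itself a competitor. The default 0 of the maximum is harmless by
  -- `z≤n`.
  rank≡rk : ∀ {a b} (M : Mat 𝔽 a b) → rank 𝔽 M ≡ rk M
  rank≡rk {a} M with S , S-size , ind , gen ← basis M = ℕ.≤-antisym
    (max≤v⁺ z≤n (ListAll.tabulate λ k∈ → case ∈-map⁻ ∣_∣ k∈ of λ { (T , T∈ , k≡) →
      subst₂ _≤_ (sym k≡) S-size (exchange {S = T} {S}
        (proj₂ (∈-filter⁻ (independentRows? 𝔽 M) {xs = subsets} T∈)) gen (span-rows M)) }))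
    (v≤max⁺ 0 _ (inj₂ (lose (∈-map⁺ ∣_∣ (∈-filter⁺ (independentRows? 𝔽 M)
      (∈-allVecs (λ { false → there (here refl) ; true → here refl }) S) ind))
      (ℕ.≤-reflexive (sym S-size)))))
    where
    subsets : List (Subset a)
    subsets = allVecs (inside List.∷ outside List.∷ List.[]) a

  rk-∈ : ∀ {a b} {M : Mat 𝔽 a b} {r} → Span M r → rk (r ∷ M) ≤ rk M
  rk-∈ {M = M} r∈M = rk-mono (r∈M ∷ span-rows M)

  rk-∉ : ∀ {a b} {M : Mat 𝔽 a b} {r} → ¬ Span M r → rk (r ∷ M) ≡ suc (rk M)
  rk-∉ {M = M} {r} r∉M with span? M r
  ... | yes r∈M = contradiction r∈M r∉M
  ... | no _    = refl

  rk-∷ : ∀ {a b} r (M : Mat 𝔽 a b) → rk (r ∷ M) ≤ suc (rk M)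
  rk-∷ r M with span? M r
  ... | yes _ = ℕ.n≤1+n _
  ... | no _  = ℕ.≤-refl

  -- A linear map preserves membership in a span, so a row that was not counted stays uncounted;
  -- every other row raises the rank of the image by at most one.
  rk-map : ∀ {a m n} {h : Vec Carrier m → Vec Carrier n} → Linear h →
           ∀ (M : Mat 𝔽 a m) → rk (Vec.map h M) ≤ rk M
  rk-map L []      = z≤n
  rk-map {h = h} L (r ∷ M) with span? M r
  ... | yes r∈M = ℕ.≤-trans (rk-∈ (span-map L r∈M)) (rk-map L M)
  ... | no _    = ℕ.≤-trans (rk-∷ (h r) (Vec.map h M)) (s≤s (rk-map L M))

  -- If `r` or `v` lies outside the span of `M`, then `t` exceeds `rk M` and any first row is
  -- allowed. Otherwise both lie in the span, which is closed under combinations.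
  rk-fibre : ∀ {a b t} r v x (M : Mat 𝔽 a b) → rk (r ∷ M) ≤ t → rk (v ∷ M) ≤ t →
             rk ((r ⊕ x ⊙ v) ∷ M) ≤ t
  rk-fibre {t = t} r v x M r≤t v≤t with span? M r | span? M v
  ... | yes r∈M | yes v∈M = ℕ.≤-trans (rk-∈ (span-⊕ r∈M (span-⊙ x v∈M))) r≤t
  ... | no _    | _       = ℕ.≤-trans (rk-∷ _ M) r≤t
  ... | yes _   | no _    = ℕ.≤-trans (rk-∷ _ M) v≤t

  size-rank : ∀ t a b → HasSize {Mat 𝔽 a b} (λ M → rk M ≤ t) (ν 𝔽 t a b)
  size-rank t a b = size-unique
    (filter⁺ rank≤t? (allVecs-unique (allVecs-unique elements-unique b) a))
    (λ M M≤t → ∈-filter⁺ rank≤t? (∈-allVecs (∈-allVecs ∈-elements) M)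
      (subst (_≤ t) (sym (rank≡rk M)) M≤t))
    (λ M M∈ → subst (_≤ t) (rank≡rk M) (proj₂ (∈-filter⁻ rank≤t? {xs = allMatrices 𝔽 a b} M∈)))
    where
    rank≤t? : Decidable (λ (M : Mat 𝔽 a b) → rank 𝔽 M ≤ t)
    rank≤t? M = rank 𝔽 M ℕ.≤? t

  Normalised : ∀ {a b} → ℕ → Mat 𝔽 a b → Mat 𝔽 a b → Set
  Normalised t F M = rk M ≤ t × evaluate 𝔽 F M ≡ 1#

  -- Schur complements

  e₁₁ : ∀ {a b} → Mat 𝔽 (suc a) (suc b)
  e₁₁ = (1# ∷ 𝟎) ∷ 0ᴹ 𝔽

  evaluate-head : ∀ {a b} (u r : Vec Carrier b) (M : Mat 𝔽 a b) →
                  evaluate 𝔽 (u ∷ 0ᴹ 𝔽) (r ∷ M) ≡ ⟨ u , r ⟩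
  evaluate-head u r M = trans (cong (⟨ u , r ⟩ +_) (evaluate-0ˡ M)) (+-identityʳ _)

  ⟨1∷𝟎,⟩ : ∀ {b} x (r : Vec Carrier b) → ⟨ 1# ∷ 𝟎 , x ∷ r ⟩ ≡ x
  ⟨1∷𝟎,⟩ x r = trans (cong₂ _+_ (*-identityˡ x) (⟨𝟎,⟩ r)) (+-identityʳ x)

  evaluate-e₁₁ : ∀ {a b} x (r : Vec Carrier b) (M : Mat 𝔽 a (suc b)) →
                 evaluate 𝔽 e₁₁ ((x ∷ r) ∷ M) ≡ x
  evaluate-e₁₁ x r M = trans (evaluate-head (1# ∷ 𝟎) (x ∷ r) M) (⟨1∷𝟎,⟩ x r)

  tail-linear : ∀ {n} → Linear (tail {n = n})
  tail-linear = record { ⊕-homo = λ { (_ ∷ _) (_ ∷ _) → refl } ; ⊙-homo = λ { _ (_ ∷ _) → refl } }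

  0∷-linear : ∀ {n} → Linear {n} (0# ∷_)
  0∷-linear = record
    { ⊕-homo = λ r s → cong (_∷ _) (sym (+-identityˡ 0#))
    ; ⊙-homo = λ x r → cong (_∷ _) (sym (zeroʳ x))
    }

  ⊙-linear : ∀ {n} x → Linear {n} (x ⊙_)
  ⊙-linear x = record
    { ⊕-homo = ⊙-distribˡ x
    ; ⊙-homo = λ y r → trans (sym (⊙-assoc x y r))
        (trans (cong (_⊙ r) (*-comm x y)) (⊙-assoc y x r))
    }

  -- The column below the pivot, the row to its right, and the Schur complement.
  SchurData : ℕ → ℕ → Set
  SchurData a b = (Vec Carrier a × Vec Carrier b) × Mat 𝔽 a b

  -- Each row is `0# ∷ d` plus `x` times the pivot row `1# ∷ r`; `unshear` subtracts that multiple
  -- again.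
  shear : ∀ {a b} → Vec Carrier b → Vec Carrier a → Mat 𝔽 a b → Mat 𝔽 a (suc b)
  shear r = zipWith (λ x d → x ∷ (d ⊕ x ⊙ r))

  unshear : ∀ {b} → Vec Carrier b → Vec Carrier (suc b) → Vec Carrier b
  unshear r s = tail s ⊕ (- head s) ⊙ r

  assemble : ∀ {a b} → SchurData a b → Mat 𝔽 (suc a) (suc b)
  assemble ((c , r) , D) = (1# ∷ r) ∷ shear r c D

  disassemble : ∀ {a b} → Mat 𝔽 (suc a) (suc b) → SchurData a b
  disassemble ((_ ∷ r) ∷ M) = (Vec.map head M , r) , Vec.map (unshear r) M

  disassemble-assemble : ∀ {a b} (z : SchurData a b) → disassemble (assemble z) ≡ z
  disassemble-assemble ((c , r) , D) = cong₂ (λ c D → (c , r) , D) (heads c D) (tails c D)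
    where
    heads : ∀ {a} c (D : Mat 𝔽 a _) → Vec.map head (shear r c D) ≡ c
    heads []      []      = refl
    heads (x ∷ c) (d ∷ D) = cong (x ∷_) (heads c D)
    tails : ∀ {a} c (D : Mat 𝔽 a _) → Vec.map (unshear r) (shear r c D) ≡ D
    tails []      []      = refl
    tails (x ∷ c) (d ∷ D) = cong₂ _∷_ (⊕-⊙-cancel d x r) (tails c D)

  -- `disassemble` forgets the corner entry. The hypothesis says that this entry is 1, the value
  -- that `assemble` puts back.
  assemble-disassemble : ∀ {a b} (M : Mat 𝔽 (suc a) (suc b)) → evaluate 𝔽 e₁₁ M ≡ 1# →
                         assemble (disassemble M) ≡ M
  assemble-disassemble ((x ∷ r) ∷ M) eq =
    cong₂ (λ y N → (y ∷ r) ∷ N) (trans (sym eq) (evaluate-e₁₁ x r M)) (rows M)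
    where
    rows : ∀ {a} (M : Mat 𝔽 a _) → shear r (Vec.map head M) (Vec.map (unshear r) M) ≡ M
    rows []            = refl
    rows ((y ∷ s) ∷ M) = cong₂ _∷_ (cong (y ∷_) (⊕-⊙-cancel′ s y r)) (rows M)

  -- Row operations with the pivot row clear the first column below it. Combinations of the cleared
  -- rows start with 0, so the pivot row is outside their span and contributes exactly one; the zero
  -- column does not affect the rank of the rest.
  rk-assemble : ∀ {a b} c r (D : Mat 𝔽 a b) → rk (assemble ((c , r) , D)) ≡ suc (rk D)
  rk-assemble {b = b} c r D = ℕ.≤-antisym
    (ℕ.≤-trans (rk-mono {N = (1# ∷ r) ∷ 0∷D}
        (span-here _ ∷ sheared c D (All.map (span-there _) (span-rows 0∷D))))
      (ℕ.≤-trans (rk-∷ (1# ∷ r) 0∷D) (s≤s (rk-map 0∷-linear D))))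
    -- Deleting the zero column is a linear map on rows, so `rk D` is at most the rank of `0∷D`.
    (ℕ.≤-trans (s≤s (subst (λ N → rk N ≤ rk 0∷D) (tail-0∷ D) (rk-map tail-linear 0∷D)))
      (ℕ.≤-trans (ℕ.≤-reflexive (sym (rk-∉ pivot∉)))
        (rk-mono {N = assemble ((c , r) , D)}
          (span-here _ ∷ unsheared c D (All.map (span-there _) (span-rows (shear r c D)))))))
    where
    0∷D = Vec.map (0# ∷_) D

    tail-0∷ : ∀ {a} (D : Mat 𝔽 a b) → Vec.map tail (Vec.map (0# ∷_) D) ≡ D
    tail-0∷ []      = refl
    tail-0∷ (d ∷ D) = cong (d ∷_) (tail-0∷ D)

    pivot∉ : ¬ Span 0∷D (1# ∷ r)
    pivot∉ (k , eq) = 1≢0 (sym (proj₁ (∷-injective (trans (Linear.lc-homo 0∷-linear k D) eq))))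

    -- `N` is independent of `D`, so the spanning rows stay fixed while the recursion consumes the
    -- rows of `D`.
    sheared : ∀ {a k} {N : Mat 𝔽 k (suc b)} c (D : Mat 𝔽 a b) →
              All (Span ((1# ∷ r) ∷ N)) (Vec.map (0# ∷_) D) →
              All (Span ((1# ∷ r) ∷ N)) (shear r c D)
    sheared []      []      []       = []
    sheared (x ∷ c) (d ∷ D) (s ∷ ss) = subst (Span _)
      (cong (_∷ (d ⊕ x ⊙ r)) (trans (+-identityˡ _) (*-identityʳ x)))
      (span-⊕ s (span-⊙ x (span-here _))) ∷ sheared c D ss

    unsheared : ∀ {a k} {N : Mat 𝔽 k (suc b)} c (D : Mat 𝔽 a b) →
                All (Span ((1# ∷ r) ∷ N)) (shear r c D) →
                All (Span ((1# ∷ r) ∷ N)) (Vec.map (0# ∷_) D)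
    unsheared []      []      []       = []
    unsheared (x ∷ c) (d ∷ D) (s ∷ ss) = subst (Span _)
      (cong₂ _∷_ (trans (cong (x +_) (*-identityʳ (- x))) (-‿inverseʳ x)) (⊕-⊙-cancel d x r))
      (span-⊕ s (span-⊙ (- x) (span-here _))) ∷ unsheared c D ss

  disassemble-injective : ∀ {a b} {M N : Mat 𝔽 (suc a) (suc b)} → evaluate 𝔽 e₁₁ M ≡ 1# →
                          evaluate 𝔽 e₁₁ N ≡ 1# → disassemble M ≡ disassemble N → M ≡ N
  disassemble-injective eq eq′ M≡N =
    trans (sym (assemble-disassemble _ eq)) (trans (cong assemble M≡N) (assemble-disassemble _ eq′))

  rk-disassemble : ∀ {a b t} (M : Mat 𝔽 (suc a) (suc b)) → Normalised (suc t) e₁₁ M →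
                   rk (proj₂ (disassemble M)) ≤ t
  rk-disassemble {t = t} M (M≤t , eq) = ℕ.≤-pred (subst (_≤ suc t)
    (trans (cong rk (sym (assemble-disassemble M eq)))
      (uncurry (uncurry rk-assemble) (disassemble M))) M≤t)

  -- Comparing linear forms

  -- Witnesses that `G` takes the value 1 on matrices of rank at most `t` at least as often as `F`
  -- does. `normalised` goes one way because the comparison is an inequality.
  record Transfer {a b} (t : ℕ) (F G : Mat 𝔽 a b) : Set where
    field
      map        : Mat 𝔽 a b → Mat 𝔽 a b
      normalised : ∀ M → Normalised t F M → Normalised t G (map M)
      injective  : ∀ {M N} → map M ≡ map N → M ≡ N

  transfer-trans : ∀ {a b t} {F G H : Mat 𝔽 a b} → Transfer t F G → Transfer t G H → Transfer t F H
  transfer-trans S T = record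
    { map        = Transfer.map T ∘ Transfer.map S
    ; normalised = λ M → Transfer.normalised T _ ∘ Transfer.normalised S M
    ; injective  = Transfer.injective S ∘ Transfer.injective T
    }

  -- Rank is controlled through `span`, since containment of row spaces survives setting a row aside
  -- in the recursion of `nonzero-row-first`.
  record RowMove {a b} (F G : Mat 𝔽 a b) : Set where
    field
      map        : Mat 𝔽 a b → Mat 𝔽 a b
      span       : ∀ M → All (Span M) (map M)
      evaluate-≡ : ∀ M → evaluate 𝔽 G (map M) ≡ evaluate 𝔽 F M
      injective  : ∀ {M N} → map M ≡ map N → M ≡ N

  -- The first nonzero row of `F` is brought to the top past the zero rows above it; the move on
  -- matrices puts their rows back in the order that `F` expects.
  nonzero-row-first : ∀ {a b} (F : Mat 𝔽 (suc a) b) → F ≢ 0ᴹ 𝔽 →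
                      ∃[ u ] ∃[ G ] u ≢ 𝟎 × RowMove (u ∷ G) F
  nonzero-row-first (u ∷ F) F≢0 with ≡-dec _≟_ u 𝟎
  nonzero-row-first (u ∷ F) F≢0 | no u≢0 = u , F , u≢0 , record
    { map = id ; span = span-rows ; evaluate-≡ = λ _ → refl ; injective = id }
  nonzero-row-first (u ∷ []) F≢0 | yes refl = contradiction refl F≢0
  nonzero-row-first (u ∷ F@(_ ∷ _)) F≢0 | yes refl
    with v , G , v≢0 , move ← nonzero-row-first F (F≢0 ∘ cong (𝟎 ∷_)) =
    v , 𝟎 ∷ G , v≢0 , record
      -- Here `r` is paired with `v` and `s` with the zero row: `s` returns to the top, and `r` goes
      -- down to be placed by the recursive move.
      { map        = λ { (r ∷ s ∷ M) → s ∷ RowMove.map move (r ∷ M) }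
      ; span       = λ { (r ∷ s ∷ M) → span-there r (span-here s) ∷
          All.map (span-trans (span-here r ∷ All.map (span-there r ∘ span-there s) (span-rows M)))
            (RowMove.span move (r ∷ M)) }
      ; evaluate-≡ = λ { (r ∷ s ∷ M) → begin
          ⟨ 𝟎 , s ⟩ + evaluate 𝔽 F (RowMove.map move (r ∷ M))
            ≡⟨ cong (⟨ 𝟎 , s ⟩ +_) (RowMove.evaluate-≡ move (r ∷ M)) ⟩
          ⟨ 𝟎 , s ⟩ + (⟨ v , r ⟩ + evaluate 𝔽 G M)
            ≡⟨ x+[y+z]≡y+[x+z] ⟨ 𝟎 , s ⟩ ⟨ v , r ⟩ (evaluate 𝔽 G M) ⟩
          ⟨ v , r ⟩ + (⟨ 𝟎 , s ⟩ + evaluate 𝔽 G M)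
            ∎ }
      ; injective  = λ { {r ∷ s ∷ M} {r′ ∷ s′ ∷ M′} eq →
          let s≡s′ , eq′ = ∷-injective eq
              r≡r′ , M≡M′ = ∷-injective (RowMove.injective move eq′)
          in cong₂ _∷_ r≡r′ (cong₂ _∷_ s≡s′ M≡M′) }
      }
    where open ≡-Reasoning

  row-transfer : ∀ {a b t} {F G : Mat 𝔽 a b} → RowMove F G → Transfer t F G
  row-transfer move = record
    { map        = RowMove.map move
    ; normalised = λ M (M≤t , eq) → ℕ.≤-trans (rk-mono (RowMove.span move M)) M≤t
                                  , trans (RowMove.evaluate-≡ move M) eq
    ; injective  = RowMove.injective move
    }

  -- Translating by a vector v with ⟨ u , v ⟩ = 1 inside the fibre absorbs the
  -- contribution of the lower rows; v may depend on the lower rows only, as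
  -- otherwise the translation need not be injective.
  translation : ∀ {a b} t (u : Vec Carrier b) (F : Mat 𝔽 a b) → Transfer t (u ∷ 0ᴹ 𝔽) (u ∷ F)
  translation {a} {b} t u F = record
    { map        = translate
    ; normalised = normal
    ; injective  = translate-injective
    }
    where
    open ≡-Reasoning

    Unit : Mat 𝔽 a b → Vec Carrier b → Set
    Unit M v = rk (v ∷ M) ≤ t × ⟨ u , v ⟩ ≡ 1#

    unit? : ∀ M → Dec (∃ (Unit M))
    unit? M = anyVec? λ v → (rk (v ∷ M) ℕ.≤? t) ×-dec (⟨ u , v ⟩ ≟ 1#)

    direction : ∀ M → Dec (∃ (Unit M)) → Vec Carrier b
    direction M (yes (v , _)) = v
    -- Over lower rows that admit no such vector there is nothing to normalise; the zero vector
    -- makes `translate` the identity there, which keeps it injective.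
    direction M (no _)        = 𝟎

    translate : Mat 𝔽 (suc a) b → Mat 𝔽 (suc a) b
    translate (r ∷ M) = (r ⊕ (- evaluate 𝔽 F M) ⊙ direction M (unit? M)) ∷ M

    normal : ∀ M → Normalised t (u ∷ 0ᴹ 𝔽) M → Normalised t (u ∷ F) (translate M)
    normal (r ∷ M) (rM≤t , eq) with unit? M
    -- The first row `r` is itself a vector of the kind said not to exist.
    ... | no ∄v = contradiction (r , rM≤t , trans (sym (evaluate-head u r M)) eq) ∄v
    ... | yes (v , vM≤t , u·v≡1) = rk-fibre r v _ M rM≤t vM≤t , (begin
      ⟨ u , r ⊕ (- e) ⊙ v ⟩ + e          ≡⟨ cong (_+ e) (⟨,⟩-⊕ u r _) ⟩
      ⟨ u , r ⟩ + ⟨ u , (- e) ⊙ v ⟩ + e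
        ≡⟨ cong₂ (λ x y → x + y + e) (trans (sym (evaluate-head u r M)) eq) (⟨,⟩-⊙ (- e) u v) ⟩
      1# + (- e) * ⟨ u , v ⟩ + e         ≡⟨ cong (λ x → 1# + (- e) * x + e) u·v≡1 ⟩
      1# + (- e) * 1# + e                ≡⟨ cong (λ x → 1# + x + e) (*-identityʳ (- e)) ⟩
      1# + (- e) + e                     ≡⟨ +-assoc 1# (- e) e ⟩
      1# + (- e + e)                     ≡⟨ cong (1# +_) (-‿inverseˡ e) ⟩
      1# + 0#                            ≡⟨ +-identityʳ 1# ⟩
      1#                                 ∎)
      where e = evaluate 𝔽 F M

    translate-injective : ∀ {M N} → translate M ≡ translate N → M ≡ N
    -- The lower rows are left unchanged, so they agree; both first rows were then shifted by the
    -- same vector.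
    translate-injective {r ∷ M} {s ∷ N} eq = case proj₂ (∷-injective eq) of λ { refl →
      cong (_∷ M) (shift-injective (proj₁ (∷-injective eq))) }
      where
      shift-injective : ∀ {r s x v} → r ⊕ (- x) ⊙ v ≡ s ⊕ (- x) ⊙ v → r ≡ s
      shift-injective {r} {s} {x} {v} eq = begin
        r                       ≡⟨ ⊕-⊙-cancel′ r x v ⟨
        r ⊕ (- x) ⊙ v ⊕ x ⊙ v   ≡⟨ cong (_⊕ x ⊙ v) eq ⟩
        s ⊕ (- x) ⊙ v ⊕ x ⊙ v   ≡⟨ ⊕-⊙-cancel′ s x v ⟩
        s                       ∎

  -- An injective column operation that pulls the form `⟨ u , _ ⟩` back to the first coordinate.
  record Straightening {n} (u : Vec Carrier (suc n)) : Set where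
    field
      map       : Vec Carrier (suc n) → Vec Carrier (suc n)
      linear    : Linear map
      ⟨,⟩-map   : ∀ x r → ⟨ u , map (x ∷ r) ⟩ ≡ x
      injective : ∀ {r s} → map r ≡ map s → r ≡ s

  straighten : ∀ {n} (u : Vec Carrier (suc n)) → u ≢ 𝟎 → Straightening u
  straighten (x ∷ u) u≢0 with x ≟ 0#
  straighten {n} (x ∷ u) u≢0 | no x≢0 with y , y*x≡1 ← inverse x≢0 = record
    -- The new first entry is the solution `k` of `x * k + ⟨ u , r ⟩ ≡ z`.
    { map       = λ { (z ∷ r) → y * (z - ⟨ u , r ⟩) ∷ r }
    ; linear    = record
      { ⊕-homo = λ { (z ∷ r) (w ∷ s) → cong (_∷ (r ⊕ s)) (⊕-homo z w r s) }
      ; ⊙-homo = λ { w (z ∷ r) → cong (_∷ (w ⊙ r)) (⊙-homo w z r) }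
      }
    ; ⟨,⟩-map   = λ z r → evaluation z ⟨ u , r ⟩
    -- Once the tails agree, `evaluation` recovers `z` and `w` from the equal first entries.
    ; injective = λ { {z ∷ r} {w ∷ s} eq → case ∷-injective eq of λ { (z≡w , refl) →
        cong (_∷ r) (trans (sym (evaluation z ⟨ u , r ⟩))
          (trans (cong (λ k → x * k + ⟨ u , r ⟩) z≡w) (evaluation w ⟨ u , r ⟩))) } }
    }
    where
    open ≡-Reasoning

    evaluation : ∀ z k → x * (y * (z - k)) + k ≡ z
    evaluation z k = begin
      x * (y * (z - k)) + k ≡⟨ cong (_+ k) (*-assoc x y _) ⟨
      x * y * (z - k) + k   ≡⟨ cong (λ i → i * (z - k) + k) (trans (*-comm x y) y*x≡1) ⟩
      1# * (z - k) + k      ≡⟨ cong (_+ k) (*-identityˡ _) ⟩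
      z - k + k             ≡⟨ +-assoc z (- k) k ⟩
      z + (- k + k)         ≡⟨ cong (z +_) (-‿inverseˡ k) ⟩
      z + 0#                ≡⟨ +-identityʳ z ⟩
      z                     ∎

    ⊕-homo : ∀ z w (r s : Vec Carrier n) →
             y * (z + w - ⟨ u , r ⊕ s ⟩) ≡ y * (z - ⟨ u , r ⟩) + y * (w - ⟨ u , s ⟩)
    ⊕-homo z w r s = begin
      y * (z + w - ⟨ u , r ⊕ s ⟩)                 ≡⟨ cong (λ k → y * (z + w - k)) (⟨,⟩-⊕ u r s) ⟩
      y * (z + w - (⟨ u , r ⟩ + ⟨ u , s ⟩))
        ≡⟨ cong (λ k → y * (z + w + k)) (sym (-‿+-comm ⟨ u , r ⟩ ⟨ u , s ⟩)) ⟩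
      y * (z + w + (- ⟨ u , r ⟩ + - ⟨ u , s ⟩))   ≡⟨ cong (y *_) (interchange z w _ _) ⟩
      y * (z - ⟨ u , r ⟩ + (w - ⟨ u , s ⟩))       ≡⟨ distribˡ y _ _ ⟩
      y * (z - ⟨ u , r ⟩) + y * (w - ⟨ u , s ⟩)   ∎

    ⊙-homo : ∀ w z (r : Vec Carrier n) → y * (w * z - ⟨ u , w ⊙ r ⟩) ≡ w * (y * (z - ⟨ u , r ⟩))
    ⊙-homo w z r = begin
      y * (w * z - ⟨ u , w ⊙ r ⟩)   ≡⟨ cong (λ k → y * (w * z - k)) (⟨,⟩-⊙ w u r) ⟩
      y * (w * z - w * ⟨ u , r ⟩)   ≡⟨ cong (λ k → y * (w * z + k)) (-‿distribʳ-* w ⟨ u , r ⟩) ⟩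
      y * (w * z + w * - ⟨ u , r ⟩) ≡⟨ cong (y *_) (distribˡ w z _) ⟨
      y * (w * (z - ⟨ u , r ⟩))     ≡⟨ *-assoc y w _ ⟨
      y * w * (z - ⟨ u , r ⟩)       ≡⟨ cong (_* (z - ⟨ u , r ⟩)) (*-comm y w) ⟩
      w * y * (z - ⟨ u , r ⟩)       ≡⟨ *-assoc w y _ ⟩
      w * (y * (z - ⟨ u , r ⟩))     ∎
  straighten {zero}  (x ∷ []) u≢0 | yes refl = contradiction refl u≢0
  straighten {suc n} (x ∷ u)  u≢0 | yes refl with S ← straighten u (u≢0 ∘ cong (0# ∷_)) = record
    -- The entry `k` is moved to the position where `u` is zero, and `z` is passed on to a nonzero
    -- coefficient.
    { map       = λ { (z ∷ k ∷ r) → k ∷ Straightening.map S (z ∷ r) }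
    ; linear    = record
      { ⊕-homo = λ { (z ∷ k ∷ r) (w ∷ l ∷ s) →
          cong (k + l ∷_) (Linear.⊕-homo (Straightening.linear S) (z ∷ r) (w ∷ s)) }
      ; ⊙-homo = λ { w (z ∷ k ∷ r) →
          cong (w * k ∷_) (Linear.⊙-homo (Straightening.linear S) w (z ∷ r)) }
      }
    ; ⟨,⟩-map   = λ { z (k ∷ r) → trans (cong (_+ ⟨ u , Straightening.map S (z ∷ r) ⟩) (zeroˡ k))
                                    (trans (+-identityˡ _) (Straightening.⟨,⟩-map S z r)) }
    ; injective = λ { {z ∷ k ∷ r} {w ∷ l ∷ s} eq →
        let k≡l , eq′ = ∷-injective eq
            z≡w , r≡s = ∷-injective (Straightening.injective S eq′)
        in cong₂ _∷_ z≡w (cong₂ _∷_ k≡l r≡s) }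
    }

  map-injective : ∀ {A B : Set} {f : A → B} → (∀ {x y} → f x ≡ f y → x ≡ y) →
                  ∀ {n} {v w : Vec A n} → Vec.map f v ≡ Vec.map f w → v ≡ w
  map-injective f-inj {v = []}    {[]}    eq = refl
  map-injective f-inj {v = x ∷ v} {y ∷ w} eq with x≡y , v≡w ← ∷-injective eq =
    cong₂ _∷_ (f-inj x≡y) (map-injective f-inj v≡w)

  column-transfer : ∀ {a b t} (u : Vec Carrier (suc b)) → u ≢ 𝟎 → Transfer {suc a} t e₁₁ (u ∷ 0ᴹ 𝔽)
  column-transfer u u≢0 = record
    { map        = Vec.map (Straightening.map S)
    ; normalised = λ { M@((x ∷ r) ∷ N) (M≤t , eq) →
        ℕ.≤-trans (rk-map (Straightening.linear S) M) M≤t ,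
        trans (evaluate-head u _ (Vec.map (Straightening.map S) N))
          (trans (Straightening.⟨,⟩-map S x r) (trans (sym (evaluate-e₁₁ x r N)) eq)) }
    ; injective  = map-injective (Straightening.injective S)
    }
    where S = straighten u u≢0

  -- The chain starts at the form of the corner entry, passes to `u` above zero rows, restores the
  -- lower rows `G`, and ends with the row order of `F`.
  e₁₁-transfer : ∀ {a b t} (F : Mat 𝔽 (suc a) (suc b)) → F ≢ 0ᴹ 𝔽 → Transfer t e₁₁ F
  e₁₁-transfer F F≢0 with u , G , u≢0 , move ← nonzero-row-first F F≢0 =
    transfer-trans (column-transfer u u≢0) (transfer-trans (translation _ u G) (row-transfer move))

  -- Codewords

  evaluate-0ʳ : ∀ {a b} (F : Mat 𝔽 a b) → evaluate 𝔽 F (0ᴹ 𝔽) ≡ 0#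
  evaluate-0ʳ []      = refl
  evaluate-0ʳ (u ∷ F) = trans (cong₂ _+_ u·0≡0 (evaluate-0ʳ F)) (+-identityˡ 0#)
    where
    u·0≡0 : ⟨ u , 𝟎 ⟩ ≡ 0#
    u·0≡0 = trans (cong ⟨ u ,_⟩ (sym (⊙-zeroˡ 𝟎))) (trans (⟨,⟩-⊙ 0# u 𝟎) (zeroˡ _))

  ·-assoc : ∀ {a b} x y (M : Mat 𝔽 a b) → _·ᴹ_ 𝔽 (x * y) M ≡ _·ᴹ_ 𝔽 x (_·ᴹ_ 𝔽 y M)
  ·-assoc x y []      = refl
  ·-assoc x y (r ∷ M) = cong₂ _∷_ (⊙-assoc x y r) (·-assoc x y M)

  ·-cancelˡ : ∀ {a b x y} → y * x ≡ 1# → (M : Mat 𝔽 a b) → _·ᴹ_ 𝔽 y (_·ᴹ_ 𝔽 x M) ≡ M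
  ·-cancelˡ y*x≡1 []      = refl
  ·-cancelˡ y*x≡1 (r ∷ M) = cong₂ _∷_ (⊙-cancelˡ y*x≡1 r) (·-cancelˡ y*x≡1 M)

  ∼-nonzero : ∀ {a b} (F : Mat 𝔽 a b) {M R} → evaluate 𝔽 F M ≡ 1# → _∼_ 𝔽 M R → evaluate 𝔽 F R ≢ 0#
  ∼-nonzero F {R = R} eq (x , _ , refl) e≡0 =
    1≢0 (trans (sym eq) (trans (evaluate-· x F R) (trans (cong (x *_) e≡0) (zeroʳ x))))

  -- With `M` and `N` equal to `x` and `y` times `R`, both scalars are inverse to the value of `F`
  -- at `R`, hence equal.
  ∼-unique : ∀ {a b} (F : Mat 𝔽 a b) {M N R} → evaluate 𝔽 F M ≡ 1# → evaluate 𝔽 F N ≡ 1# →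
             _∼_ 𝔽 M R → _∼_ 𝔽 N R → M ≡ N
  ∼-unique F {R = R} eq eq′ (x , _ , refl) (y , _ , refl) = cong (λ z → _·ᴹ_ 𝔽 z R) (begin
    x            ≡⟨ *-identityʳ x ⟨
    x * 1#       ≡⟨ cong (x *_) (trans (sym (evaluate-· y F R)) eq′) ⟨
    x * (y * e)  ≡⟨ cong (x *_) (*-comm y e) ⟩
    x * (e * y)  ≡⟨ *-assoc x e y ⟨
    x * e * y    ≡⟨ cong (_* y) (trans (sym (evaluate-· x F R)) eq) ⟩
    1# * y       ≡⟨ *-identityˡ y ⟩
    y            ∎)
    where
    open ≡-Reasoning
    e = evaluate 𝔽 F R

  module _ {t a b n : ℕ} (P : ProjectiveEnumeration 𝔽 t a b n) (F : Mat 𝔽 a b) where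
    open ProjectiveEnumeration P

    codeword : Vec Carrier n
    codeword = Vec.map (evaluate 𝔽 F) representatives

    size-codeword : HasSize (λ i → evaluate 𝔽 F (lookup representatives i) ≢ 0#) (weight 𝔽 codeword)
    size-codeword = size-map id id (λ _ → refl) (λ _ → refl)
      (λ i → subst (_≢ 0#) (lookup-map i (evaluate 𝔽 F) representatives))
      (λ i → subst (_≢ 0#) (sym (lookup-map i (evaluate 𝔽 F) representatives)))
      (size-count (λ x → ¬? (x ≟ 0#)) codeword)

    point : ∀ M → Normalised t F M → ∃[ i ] _∼_ 𝔽 M (lookup representatives i)
    point M (M≤t , eq) = complete M
      (λ { refl → 1≢0 (trans (sym eq) (evaluate-0ʳ F)) }) (subst (_≤ t) (sym (rank≡rk M)) M≤t)

    point-nonzero : ∀ M p → evaluate 𝔽 F (lookup representatives (proj₁ (point M p))) ≢ 0#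
    point-nonzero M p = ∼-nonzero F (proj₂ p) (proj₂ (point M p))

    point-injective : ∀ {M N} p p′ → proj₁ (point M p) ≡ proj₁ (point N p′) → M ≡ N
    point-injective {M} {N} p p′ i≡j = ∼-unique F (proj₂ p) (proj₂ p′) (proj₂ (point M p))
      (subst (λ j → _∼_ 𝔽 N (lookup representatives j)) (sym i≡j) (proj₂ (point N p′)))

    normalise : ∀ i → evaluate 𝔽 F (lookup representatives i) ≢ 0# → Mat 𝔽 a b
    normalise i e≢0 = _·ᴹ_ 𝔽 (proj₁ (inverse e≢0)) (lookup representatives i)

    normalise-normalised : ∀ i e≢0 → Normalised t F (normalise i e≢0)
    normalise-normalised i e≢0 =
      ℕ.≤-trans (rk-map (⊙-linear _) (lookup representatives i))
        (subst (_≤ t) (rank≡rk (lookup representatives i)) (rank≤t i)) ,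
      trans (evaluate-· _ F (lookup representatives i)) (proj₂ (inverse e≢0))

    -- Undoing the first scaling presents one representative as a multiple of the other. The factor
    -- is nonzero because `F` does not vanish on the first one, so `distinct` identifies the points.
    normalise-injective : ∀ {i j} p p′ → normalise i p ≡ normalise j p′ → i ≡ j
    normalise-injective {i} {j} p p′ eq = distinct i j (x * y′ , x*y′≢0 , M≡x*y′·N)
      where
      M = lookup representatives i
      N = lookup representatives j
      x = evaluate 𝔽 F M
      y′ = proj₁ (inverse p′)
      M≡x*y′·N : M ≡ _·ᴹ_ 𝔽 (x * y′) N
      M≡x*y′·N = trans (sym (·-cancelˡ (trans (*-comm _ _) (proj₂ (inverse p))) M))
        (trans (cong (_·ᴹ_ 𝔽 x) eq) (sym (·-assoc x y′ N)))
      x*y′≢0 : x * y′ ≢ 0#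
      x*y′≢0 z≡0 = p (trans (cong (evaluate 𝔽 F) M≡x*y′·N)
        (trans (evaluate-· (x * y′) F N) (trans (cong (_* evaluate 𝔽 F N) z≡0) (zeroˡ _))))

  -- The minimum distance

  size-SchurData : ∀ t a b → HasSize {SchurData a b} (λ (_ , D) → (⊤ × ⊤) × rk D ≤ t)
                                     (q ^ a ℕ.* q ^ b ℕ.* ν 𝔽 t a b)
  size-SchurData t a b =
    size-× (size-× (size-Vec size-Carrier a) (size-Vec size-Carrier b)) (size-rank t a b)

  module _ {t a b n : ℕ} (P : ProjectiveEnumeration 𝔽 (suc t) (suc a) (suc b) n) where

    -- Schur data inject into the support of the codeword: assemble a matrix with corner 1, transfer
    -- it to one on which `F` is 1, and take its projective point.
    weight-≥-transfer : ∀ {F} → Transfer (suc t) e₁₁ F →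
                        q ^ a ℕ.* q ^ b ℕ.* ν 𝔽 t a b ≤ weight 𝔽 (codeword P F)
    weight-≥-transfer {F} T = size-≤ (size-SchurData t a b) (size-codeword P F)
      (λ z p → proj₁ (point P F (matrix z) (normal z p)))
      (λ z p → point-nonzero P F (matrix z) (normal z p))
      (λ {z} {z′} p p′ eq → matrix-injective
        (point-injective P F {matrix z} {matrix z′} (normal z p) (normal z′ p′) eq))
      where
      open ≡-Reasoning

      matrix : SchurData a b → Mat 𝔽 (suc a) (suc b)
      matrix z = Transfer.map T (assemble z)

      normal : ∀ z → (⊤ × ⊤) × rk (proj₂ z) ≤ t → Normalised (suc t) F (matrix z)
      normal ((c , r) , D) (_ , D≤t) = Transfer.normalised T _
        (ℕ.≤-trans (ℕ.≤-reflexive (rk-assemble c r D)) (s≤s D≤t) , evaluate-e₁₁ 1# r (shear r c D))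

      matrix-injective : ∀ {z z′} → matrix z ≡ matrix z′ → z ≡ z′
      matrix-injective {z} {z′} eq = begin
        z                         ≡⟨ disassemble-assemble z ⟨
        disassemble (assemble z)  ≡⟨ cong disassemble (Transfer.injective T eq) ⟩
        disassemble (assemble z′) ≡⟨ disassemble-assemble z′ ⟩
        z′                        ∎

    weight-≥ : ∀ F → F ≢ 0ᴹ 𝔽 → q ^ a ℕ.* q ^ b ℕ.* ν 𝔽 t a b ≤ weight 𝔽 (codeword P F)
    weight-≥ F F≢0 = weight-≥-transfer (e₁₁-transfer F F≢0)

    -- The reverse injection: each point of the support is scaled to have corner 1 and is then
    -- recovered from its Schur data.
    weight-e₁₁-≤ : weight 𝔽 (codeword P e₁₁) ≤ q ^ a ℕ.* q ^ b ℕ.* ν 𝔽 t a b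
    weight-e₁₁-≤ = size-≤ (size-codeword P e₁₁) (size-SchurData t a b)
      (λ i p → disassemble (normalise P e₁₁ i p))
      (λ i p → (tt , tt) , rk-disassemble (normalise P e₁₁ i p) (normalise-normalised P e₁₁ i p))
      (λ {i} {j} p p′ eq → normalise-injective P e₁₁ p p′ (disassemble-injective
        (proj₂ (normalise-normalised P e₁₁ i p)) (proj₂ (normalise-normalised P e₁₁ j p′)) eq))

    e₁₁≢0 : e₁₁ {a} {b} ≢ 0ᴹ 𝔽
    e₁₁≢0 eq = 1≢0 (proj₁ (∷-injective (proj₁ (∷-injective eq))))

    -- Read as a matrix, `e₁₁` has rank at most one and value 1 under the form `e₁₁`; its point is
    -- thus a nonzero coordinate of the codeword.
    e₁₁-normalised : Normalised (suc t) (e₁₁ {a} {b}) e₁₁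
    e₁₁-normalised =
      ℕ.≤-trans (rk-∷ (1# ∷ 𝟎) (0ᴹ 𝔽 {a})) (s≤s (ℕ.≤-trans (rk-mono {N = []} (zero-rows a)) z≤n)) ,
      evaluate-e₁₁ 1# 𝟎 (0ᴹ 𝔽 {a})
      where
      zero-rows : ∀ k → All (Span {0} []) (0ᴹ 𝔽 {k} {suc b})
      zero-rows zero    = []
      zero-rows (suc k) = span-𝟎 ∷ zero-rows k

    codeword-e₁₁≢0 : codeword P e₁₁ ≢ 0ᵛ 𝔽
    codeword-e₁₁≢0 eq = point-nonzero P e₁₁ e₁₁ e₁₁-normalised (begin
      evaluate 𝔽 e₁₁ (lookup representatives i) ≡⟨ lookup-map i (evaluate 𝔽 e₁₁) representatives ⟨
      lookup (codeword P e₁₁) i                 ≡⟨ cong (λ c → lookup c i) eq ⟩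
      lookup (0ᵛ 𝔽) i                           ≡⟨ lookup-replicate i 0# ⟩
      0#                                        ∎)
      where
      open ≡-Reasoning
      open ProjectiveEnumeration P using (representatives)
      i : Fin n
      i = proj₁ (point P e₁₁ e₁₁ e₁₁-normalised)

    codeword≢0⇒form≢0 : ∀ F → codeword P F ≢ 0ᵛ 𝔽 → F ≢ 0ᴹ 𝔽
    codeword≢0⇒form≢0 F c≢0 refl = c≢0 (trans (map-cong evaluate-0ˡ _) (map-const _ 0#))

    minimumDistance : IsMinimumDistance 𝔽 (Ĉdet 𝔽 P) (q ^ a ℕ.* q ^ b ℕ.* ν 𝔽 t a b)
    minimumDistance = record
      { attained = codeword P e₁₁ , (e₁₁ , refl) , codeword-e₁₁≢0
                 , ℕ.≤-antisym weight-e₁₁-≤ (weight-≥ e₁₁ e₁₁≢0)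
      ; minimal  = λ { c (F , refl) c≢0 → weight-≥ F (codeword≢0⇒form≢0 F c≢0) }
      }

open import Data.Nat.Base using (_+_; _*_; _∸_)

mainTheorem6 : ∀ {q : ℕ} (𝔽 : FiniteField q) (t ℓ m : ℕ) → 1 ≤ t → t ≤ ℓ → ℓ ≤ m →
    ∀ {n̂ : ℕ} (P : ProjectiveEnumeration 𝔽 t ℓ m n̂) →
    IsMinimumDistance 𝔽 (Ĉdet 𝔽 P) (q ^ (ℓ + m ∸ 2) * ν 𝔽 (t ∸ 1) (ℓ ∸ 1) (m ∸ 1))
-- The inequalities leave only successors: `t` is at least 1, and `ℓ` and `m` are at least `t`.
mainTheorem6 {q} 𝔽 (suc t) (suc a) (suc b) _ _ _ P =
  subst (λ k → IsMinimumDistance 𝔽 (Ĉdet 𝔽 P) (k * ν 𝔽 t a b)) q^a*q^b≡ (minimumDistance 𝔽 P)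
  where
  q^a*q^b≡ : q ^ a * q ^ b ≡ q ^ (a + suc b ∸ 1)
  -- The exponent `suc a + suc b ∸ 2` computes only as far as `a + suc b ∸ 1`; `+-suc` exposes the
  -- second successor to be cancelled.
  q^a*q^b≡ = trans (sym (ℕ.^-distribˡ-+-* q a b)) (cong (λ k → q ^ (k ∸ 1)) (sym (ℕ.+-suc a b)))
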